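{- For every integer $s \geq 2$ there exist infinitely many (pairwise non-isomorphic) $2$-designs $\mathscr{D}=(\mathscr{P},\mathscr{B})$ (with block size $k$ satisfying $2\le k<|\mathscr{P}|$) such that some subgroup $G\leq \mathrm{Aut}(\mathscr{D})$ acts flag-transitively on $\mathscr{D}$ and $s$-chain-imprimitively on $\mathscr{P}$.
   Context: A $2$-$(v,k,\lambda)$ design is a pair $\mathscr{D}=(\mathscr{P},\mathscr{B})$ where $\mathscr{P}$ is a finite set of $v$ points, $\mathscr{B}$ is a nonempty set of $k$-element subsets of $\mathscr{P}$ (blocks), and any two distinct points are contained in exactly $\lambda$ blocks; a $2$-design is a $2$-$(v,k,\lambda)$ design for some $v,k,\lambda$. $\mathrm{Aut}(\mathscr{D})$ is the group of permutations of $\mathscr{P}$ that map $\mathscr{B}$ to itself. A flag is a pair $(\delta,B)\in\mathscr{P}\times\mathscr{B}$ with $\delta\in B$; $G\le\mathrm{Aut}(\mathscr{D})$ is flag-transitive if it is transitive on the set of flags. For partitions of $\mathscr{P}$, $\mathscr{C}\prec\mathscr{C}'$ means that each $\mathscr{C}$-class is a proper subset of some $\mathscr{C}'$-class. $G$ acts $s$-chain-imprimitively on $\mathscr{P}$ if $G$ is transitive on $\mathscr{P}$ and leaves invariant each partition in some chain of partitions $\mathscr{C}_0\prec\mathscr{C}_1\prec\cdots\prec\mathscr{C}_s$ of $\mathscr{P}$, where $\mathscr{C}_0$ is the partition into singletons and $\mathscr{C}_s=\{\mathscr{P}\}$. -}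

module Defs where

open import Data.Fin.Base using (Fin; zero; suc; inject₁; fromℕ)
open import Data.Fin.Permutation
  using (Permutation; Permutation′; _⟨$⟩ʳ_; _⟨$⟩ˡ_; _∘ₚ_; flip; _≈_)
  renaming (id to idₚ)
open import Data.Fin.Subset using (Subset; _∈_; _⊂_; ⊤; ⁅_⁆; ∣_∣; Nonempty)
open import Data.Fin.Subset.Properties using (_∈?_)
open import Data.List.Base using (List; []; length; filter)
import Data.List.Membership.Propositional as List
open import Data.List.Relation.Unary.Unique.Propositional using (Unique)
open import Data.Nat.Base using (ℕ)
open import Data.Product.Base using (_×_; ∃-syntax)
open import Data.Vec.Base using (lookup; tabulate)
open import Function.Bundles using (_⇔_)
open import Level using (0ℓ)
open import Relation.Binary.PropositionalEquality.Core using (_≡_; _≢_)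
open import Relation.Nullary.Decidable using (_×-dec_)
open import Relation.Unary using (Pred; _≐_)

private
  variable
    m n : ℕ

image : Permutation m n → Subset m → Subset n
image π p = tabulate λ y → lookup p (π ⟨$⟩ˡ y)

-- As π is a bijection, so is `image π`, and hence the equivalence below says
-- that { image π p | p ∈ 𝒮 } is equal to 𝒯.
MapsOnto : Permutation m n → Pred (Subset m) 0ℓ → Pred (Subset n) 0ℓ → Set
MapsOnto π 𝒮 𝒯 = ∀ p → 𝒮 p ⇔ 𝒯 (image π p)

------------------------------------------------------------------------
-- Designs

-- 2-(v,k,lam) designs with point set Fin v. The set of blocks is listed
-- without repetition, so that `length` counts blocks.
record Design (v k lam : ℕ) : Set where
  field
    blocks    : List (Subset v)
    unique    : Unique blocks
    nonempty  : blocks ≢ []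
    blockSize : ∀ {B} → B List.∈ blocks → ∣ B ∣ ≡ k
    balanced  : ∀ {x y} → x ≢ y →
                length (filter (λ B → x ∈? B ×-dec y ∈? B) blocks) ≡ lam

  IsBlock : Pred (Subset v) 0ℓ
  IsBlock B = B List.∈ blocks

record 2-Design : Set where
  field
    {v k lam} : ℕ
    design    : Design v k lam

  open Design design public

IsIsomorphism : (𝒟 ℰ : 2-Design) →
                Permutation (2-Design.v 𝒟) (2-Design.v ℰ) → Set
IsIsomorphism 𝒟 ℰ π = MapsOnto π (2-Design.IsBlock 𝒟) (2-Design.IsBlock ℰ)

Isomorphic : 2-Design → 2-Design → Set
Isomorphic 𝒟 ℰ = ∃[ π ] IsIsomorphism 𝒟 ℰ π

------------------------------------------------------------------------
-- Permutation groups

record PermutationGroup (n : ℕ) : Set₁ where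
  field
    member    : Pred (Permutation′ n) 0ℓ
    -- A permutation carries its inverse and correctness proofs, so
    -- membership must be required to depend on the underlying function only.
    resp-≈    : ∀ {g h} → g ≈ h → member g → member h
    id-closed : member idₚ
    ∘-closed  : ∀ {g h} → member g → member h → member (g ∘ₚ h)
    ⁻¹-closed : ∀ {g} → member g → member (flip g)

open PermutationGroup public using (member)

SubgroupOfAut : (𝒟 : 2-Design) → PermutationGroup (2-Design.v 𝒟) → Set
SubgroupOfAut 𝒟 G = ∀ {g} → member G g → IsIsomorphism 𝒟 𝒟 g

Transitive : PermutationGroup n → Set
Transitive G = ∀ x y → ∃[ g ] member G g × g ⟨$⟩ʳ x ≡ y

IsFlag : (𝒟 : 2-Design) → Fin (2-Design.v 𝒟) → Subset (2-Design.v 𝒟) → Set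
IsFlag 𝒟 x B = 2-Design.IsBlock 𝒟 B × x ∈ B

FlagTransitive : (𝒟 : 2-Design) → PermutationGroup (2-Design.v 𝒟) → Set
FlagTransitive 𝒟 G =
  ∀ {x B y C} → IsFlag 𝒟 x B → IsFlag 𝒟 y C →
  ∃[ g ] member G g × g ⟨$⟩ʳ x ≡ y × image g B ≡ C

------------------------------------------------------------------------
-- Partitions and chains of partitions

record Partition (n : ℕ) : Set₁ where
  field
    IsClass  : Pred (Subset n) 0ℓ
    nonempty : ∀ {p} → IsClass p → Nonempty p
    covering : ∀ x → ∃[ p ] IsClass p × x ∈ p
    disjoint : ∀ {p q x} → IsClass p → IsClass q → x ∈ p → x ∈ q → p ≡ q

open Partition public using (IsClass)

infix 4 _≺_

_≺_ : Partition n → Partition n → Set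
𝒞 ≺ 𝒞′ = ∀ {p} → IsClass 𝒞 p → ∃[ q ] IsClass 𝒞′ q × p ⊂ q

Invariant : PermutationGroup n → Partition n → Set
Invariant G 𝒞 = ∀ {g} → member G g → MapsOnto g (IsClass 𝒞) (IsClass 𝒞)

record ChainImprimitive (s : ℕ) (G : PermutationGroup n) : Set₁ where
  field
    transitive : Transitive G
    chain      : Fin (ℕ.suc s) → Partition n
    increasing : ∀ (i : Fin s) → chain (inject₁ i) ≺ chain (suc i)
    bottom     : IsClass (chain zero) ≐ λ p → ∃[ x ] p ≡ ⁅ x ⁆
    top        : IsClass (chain (fromℕ s)) ≐ (_≡ ⊤)
    invariant  : ∀ i → Invariant G (chain i)

{-# OPTIONS --safe #-}

-- Start from the one-point design and iterate the following step. Given a design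
-- with v = 2k − 1 points, the new points are v + 2 disjoint copies (fibres) of the
-- old point set, and a new block misses one fibre and meets every other fibre in
-- an old block, these being chosen independently. With b blocks, r of them through
-- each point, and r = 2λ, two points of the same fibre lie in (v + 1) λ b^v new
-- blocks and two points of distinct fibres in v r² b^(v−1); these agree because
-- b k = v r and v + 1 = 2k. The new design has (v + 2) v = 2 (v + 1) k − 1 points,
-- so the construction goes on. Wreath products of automorphisms with permutations
-- of the fibres act flag-transitively, and the fibres add one partition to the chain.

module Submission where

open import Defs
open import Data.Bool.Base using (Bool; true; false; _∧_; if_then_else_)
open import Data.Bool.Properties using (∧-comm; ∧-identityʳ)
open import Data.Fin.Base
  using (Fin; zero; suc; combine; remQuot; inject₁; fromℕ; fromℕ<; toℕ; punchIn)
open import Data.Fin.Permutation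
  using (Permutation′; _⟨$⟩ʳ_; _⟨$⟩ˡ_; _∘ₚ_; flip; inverseˡ; inverseʳ; permutation; transpose; ↔⇒≡)
  renaming (id to idₚ; _≈_ to _≈ₚ_)
open import Data.Fin.Properties
  using (_≟_; remQuot-combine; combine-injective; combine-surjective; punchInᵢ≢i;
         toℕ-inject₁; toℕ<n; toℕ-fromℕ)
open import Data.Fin.Subset using (Subset; ⊥; ⊤; ⁅_⁆; ∣_∣; Nonempty) renaming (_∈_ to _∈ₛ_)
open import Data.Fin.Subset.Properties
  using (_∈?_; ∣⊥∣≡0; nonempty?; Empty-unique; x∈⁅x⁆; ⊆-antisym; x∈⁅y⁆⇒x≡y; ∈⊤; ∉⊥)
open import Data.List.Base using (List; []; _∷_; _++_; map; length; filter; cartesianProductWith)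
open import Data.List.Membership.Propositional using (_∈_; _∉_)
open import Data.List.Membership.Propositional.Properties
  using (∈-map⁺; ∈-map⁻; ∈-++⁺ˡ; ∈-++⁺ʳ; ∈-++⁻; ∈-cartesianProductWith⁺; ∈-cartesianProductWith⁻)
open import Data.List.Properties using (length-map)
open import Data.List.Relation.Unary.All using ([]; _∷_)
open import Data.List.Relation.Unary.AllPairs using ([]; _∷_)
open import Data.List.Relation.Unary.Any using (here)
open import Data.List.Relation.Unary.Unique.Propositional using (Unique)
import Data.List.Relation.Unary.Unique.Propositional.Properties as Unique
open import Data.Nat.Base
open import Data.Nat.DivMod using (m*n/n≡m)
open import Data.Nat.Properties hiding (_≟_)
open import Data.Nat.Tactic.RingSolver using (solve-∀)
open import Data.Product.Base using (_×_; _,_; proj₁; proj₂; Σ-syntax; ∃-syntax)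
open import Data.Sum.Base using (inj₁; inj₂)
open import Data.Vec.Base as Vec using (Vec; []; _∷_; lookup; tabulate; concat)
open import Data.Vec.Properties
  using (∷-injective; ∷-injectiveʳ; ++-injective; lookup-concat; lookup-replicate;
         lookup∘tabulate; tabulate∘lookup; tabulate-cong; []=⇒lookup; lookup⇒[]=)
open import Function.Base using (_∘_; const; id)
open import Function.Bundles using (mk⇔)
open import Relation.Binary.Definitions using (tri<; tri≈; tri>)
open import Relation.Binary.PropositionalEquality
open import Relation.Nullary.Decidable
  using (Dec; yes; no; does; does-⇔; dec-true; dec-false; _×-dec_)
open import Relation.Nullary.Negation using (¬_; contradiction)

open ≡-Reasoning

private
  variable
    A B C : Set
    e m n o : ℕ

vec-ext : {xs ys : Vec A n} → (∀ i → lookup xs i ≡ lookup ys i) → xs ≡ ys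
vec-ext {xs = xs} {ys} eq =
  trans (sym (tabulate∘lookup xs)) (trans (tabulate-cong eq) (tabulate∘lookup ys))

concat-injective : {xss yss : Vec (Vec A n) m} → concat xss ≡ concat yss → xss ≡ yss
concat-injective {xss = []}     {[]}     _  = refl
concat-injective {xss = xs ∷ _} {ys ∷ _} eq with ++-injective xs ys eq
... | refl , eq′ = cong (xs ∷_) (concat-injective eq′)

-- Counting

-- Predicates are Boolean so that a joint condition is an `∧`, which splits over the factors of a
-- product and computes after a `with`.
count : (A → Bool) → List A → ℕ
count p []       = 0
count p (x ∷ xs) = if p x then suc (count p xs) else count p xs

length-filter≡count : {P : A → Set} (P? : ∀ x → Dec (P x)) (p : A → Bool) →
                      (∀ x → does (P? x) ≡ p x) →
                      ∀ xs → length (filter P? xs) ≡ count p xs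
length-filter≡count P? p eq []       = refl
length-filter≡count P? p eq (x ∷ xs)
  with does (P? x) | p x | eq x | length-filter≡count P? p eq xs
... | true  | true  | refl | ih = cong suc ih
... | false | false | refl | ih = ih

count-cong : {p q : A → Bool} → (∀ x → p x ≡ q x) → ∀ xs → count p xs ≡ count q xs
count-cong         eq []       = refl
count-cong {p = p} {q} eq (x ∷ xs)
  with p x | q x | eq x | count-cong eq xs
... | true  | true  | refl | ih = cong suc ih
... | false | false | refl | ih = ih

count-true : (xs : List A) → count (const true) xs ≡ length xs
count-true []       = refl
count-true (x ∷ xs) = cong suc (count-true xs)

count-false : (xs : List A) → count (const false) xs ≡ 0
count-false []       = refl
count-false (x ∷ xs) = count-false xs

count-++ : ∀ (p : A → Bool) xs ys → count p (xs ++ ys) ≡ count p xs + count p ys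
count-++ p []       ys = refl
count-++ p (x ∷ xs) ys with p x
... | true  = cong suc (count-++ p xs ys)
... | false = count-++ p xs ys

count-map : ∀ (p : B → Bool) (f : A → B) xs → count p (map f xs) ≡ count (p ∘ f) xs
count-map p f []       = refl
count-map p f (x ∷ xs) with p (f x)
... | true  = cong suc (count-map p f xs)
... | false = count-map p f xs

-- Independence of two coordinates. An unconstrained coordinate is handled by taking `const true` as
-- its predicate.
count-cartesianProductWith :
  ∀ (f : A → B → C) (p : A → Bool) (q : B → Bool) (s : C → Bool) →
  (∀ x y → s (f x y) ≡ p x ∧ q y) →
  ∀ xs ys → count s (cartesianProductWith f xs ys) ≡ count p xs * count q ys
count-cartesianProductWith f p q s eq []       ys = refl
count-cartesianProductWith f p q s eq (x ∷ xs) ys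
  rewrite count-++ s (map (f x) ys) (cartesianProductWith f xs ys)
        | count-map s (f x) ys
        | count-cong (eq x) ys
        | count-cartesianProductWith f p q s eq xs ys
  with p x
... | true  = refl
... | false rewrite count-false ys = refl

left-comm : ∀ a b c → a * (b * c) ≡ b * (a * c)
left-comm = solve-∀

-- Vectors with entries from a list

module Vectors (xs : List A) where

  full : ∀ e → List (Vec A e)
  full zero    = [] ∷ []
  full (suc e) = cartesianProductWith _∷_ xs (full e)

  full-unique : Unique xs → ∀ e → Unique (full e)
  full-unique xs! zero    = [] ∷ []
  full-unique xs! (suc e) =
    Unique.cartesianProductWith⁺ _∷_ ∷-injective xs! (full-unique xs! e)

  ∈-full⁺ : {v : Vec A e} → (∀ i → lookup v i ∈ xs) → v ∈ full e
  ∈-full⁺ {v = []}    ∈xs = here refl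
  ∈-full⁺ {v = x ∷ v} ∈xs =
    ∈-cartesianProductWith⁺ _∷_ (∈xs zero) (∈-full⁺ (∈xs ∘ suc))

  ∈-full⁻ : {v : Vec A e} → v ∈ full e → ∀ i → lookup v i ∈ xs
  ∈-full⁻ {suc e} v∈ i with ∈-cartesianProductWith⁻ _∷_ xs (full e) v∈
  ∈-full⁻ {suc e} v∈ zero    | _ , _ , x∈xs , _ , refl = x∈xs
  ∈-full⁻ {suc e} v∈ (suc i) | _ , _ , _ , v∈′ , refl  = ∈-full⁻ v∈′ i

  length-full-suc : ∀ e → length (full (suc e)) ≡ length xs * length (full e)
  length-full-suc e = begin
    length (full (suc e))
      ≡⟨ count-true (full (suc e)) ⟨
    count (const true) (full (suc e))
      ≡⟨ count-cartesianProductWith _∷_ _ _ _ (λ _ _ → refl) xs (full e) ⟩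
    count (const true) xs * count (const true) (full e)
      ≡⟨ cong₂ _*_ (count-true xs) (count-true (full e)) ⟩
    length xs * length (full e)
      ∎

  length-full : ∀ e → length (full e) ≡ length xs ^ e
  length-full zero    = refl
  length-full (suc e) = trans (length-full-suc e) (cong (length xs *_) (length-full e))

  count-full : ∀ (p : A → Bool) i →
               count (λ v → p (lookup v i)) (full (suc e)) ≡ count p xs * length (full e)
  count-full {e} p zero = trans
    (count-cartesianProductWith _∷_ p (const true) _ (λ x _ → sym (∧-identityʳ (p x)))
       xs (full e))
    (cong (count p xs *_) (count-true (full e)))
  count-full {suc e} p (suc i)
    rewrite count-cartesianProductWith _∷_ (const true) (λ v → p (lookup v i))
              (λ v → p (lookup v (suc i))) (λ _ _ → refl) xs (full (suc e))
          | count-true xs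
          | count-full {e} p i
          | length-full-suc e
          = left-comm (length xs) (count p xs) (length (full e))

  -- Entries at distinct positions vary independently, and `e` further entries remain free.
  count-full₂ :
    ∀ (p q : A → Bool) i j → i ≢ j →
    count (λ v → p (lookup v i) ∧ q (lookup v j)) (full (2+ e)) ≡
    count p xs * (count q xs * length (full e))
  count-full₂ p q zero zero i≢j = contradiction refl i≢j
  count-full₂ {e} p q zero (suc j) i≢j = trans
    (count-cartesianProductWith _∷_ p (λ v → q (lookup v j)) _ (λ _ _ → refl)
       xs (full (suc e)))
    (cong (count p xs *_) (count-full q j))
  count-full₂ {e} p q (suc i) zero i≢j = begin
    count (λ v → p (lookup v (suc i)) ∧ q (lookup v zero)) (full (2+ e))
      ≡⟨ count-cong (λ v → ∧-comm (p (lookup v (suc i))) _) (full (2+ e)) ⟩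
    count (λ v → q (lookup v zero) ∧ p (lookup v (suc i))) (full (2+ e))
      ≡⟨ count-full₂ q p zero (suc i) (i≢j ∘ sym) ⟩
    count q xs * (count p xs * length (full e))
      ≡⟨ left-comm (count q xs) (count p xs) _ ⟩
    count p xs * (count q xs * length (full e))
      ∎
  count-full₂ {zero}  p q (suc zero) (suc zero) i≢j = contradiction refl i≢j
  count-full₂ {suc e} p q (suc i) (suc j) i≢j
    rewrite count-cartesianProductWith _∷_ (const true) (λ v → p (lookup v i) ∧ q (lookup v j))
              (λ v → p (lookup v (suc i)) ∧ q (lookup v (suc j))) (λ _ _ → refl)
              xs (full (2+ e))
          | count-full₂ {e} p q i j (i≢j ∘ cong suc)
          | count-true xs
          | length-full-suc e
          = rearrange (length xs) (count p xs) (count q xs) (length (full e))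
    where
    rearrange : ∀ a b c d → a * (b * (c * d)) ≡ b * (c * (a * d))
    rearrange = solve-∀

  -- Vectors with one gap

  module Punctured (∅ : A) where

    -- `∅` marks the gap and all other entries come from `xs`. The first summand puts the gap in
    -- front, the second further back; they are disjoint if `∅ ∉ xs`.
    punctured : ∀ e → List (Vec A e)
    punctured zero    = []
    punctured (suc e) =
      map (∅ ∷_) (full e) ++ cartesianProductWith _∷_ xs (punctured e)

    punctured-unique : ∅ ∉ xs → Unique xs → ∀ e → Unique (punctured e)
    punctured-unique ∅∉ xs! zero    = []
    punctured-unique ∅∉ xs! (suc e) = Unique.++⁺
      (Unique.map⁺ ∷-injectiveʳ (full-unique xs! e))
      (Unique.cartesianProductWith⁺ _∷_ ∷-injective xs! (punctured-unique ∅∉ xs! e))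
      λ (v∈l , v∈r) → disjoint (∈-map⁻ (∅ ∷_) v∈l)
                               (∈-cartesianProductWith⁻ _∷_ xs (punctured e) v∈r)
      where
      disjoint : ∀ {v} → (∃[ w ] w ∈ full e × v ≡ ∅ ∷ w) →
                 ¬ (∃[ x ] ∃[ w ] x ∈ xs × w ∈ punctured e × v ≡ x ∷ w)
      disjoint (_ , _ , refl) (_ , _ , ∅∈ , _ , refl) = ∅∉ ∅∈

    ∈-punctured⁺ : {v : Vec A e} (j : Fin e) → lookup v j ≡ ∅ →
                   (∀ i → i ≢ j → lookup v i ∈ xs) → v ∈ punctured e
    ∈-punctured⁺ {v = x ∷ v} zero    refl ∈xs =
      ∈-++⁺ˡ (∈-map⁺ (∅ ∷_) (∈-full⁺ λ i → ∈xs (suc i) λ ()))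
    ∈-punctured⁺ {suc e} {v = x ∷ v} (suc j) eq ∈xs =
      ∈-++⁺ʳ (map (∅ ∷_) (full e))
        (∈-cartesianProductWith⁺ _∷_ (∈xs zero λ ())
          (∈-punctured⁺ j eq λ i i≢j → ∈xs (suc i) λ { refl → i≢j refl }))

    ∈-punctured⁻ : {v : Vec A e} → v ∈ punctured e →
                   ∃[ j ] lookup v j ≡ ∅ × (∀ i → i ≢ j → lookup v i ∈ xs)
    ∈-punctured⁻ {suc e} {v} v∈ with ∈-++⁻ (map (∅ ∷_) (full e)) v∈
    ... | inj₁ v∈l with ∈-map⁻ (∅ ∷_) v∈l
    ... | w , w∈ , refl = zero , refl , ∈xs
      where
      ∈xs : ∀ i → i ≢ zero → lookup v i ∈ xs
      ∈xs zero    0≢0 = contradiction refl 0≢0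
      ∈xs (suc i) _   = ∈-full⁻ w∈ i
    ∈-punctured⁻ {suc e} {v} v∈ | inj₂ v∈r
      with ∈-cartesianProductWith⁻ _∷_ xs (punctured e) v∈r
    ... | x , w , x∈ , w∈ , refl with ∈-punctured⁻ w∈
    ... | j , eq , w∈xs = suc j , eq , ∈xs
      where
      ∈xs : ∀ i → i ≢ suc j → lookup v i ∈ xs
      ∈xs zero    _   = x∈
      ∈xs (suc i) i≢j = w∈xs i (i≢j ∘ cong suc)

    -- Entry `i` of the new vector comes from position `τ i`, so a gap at `j` moves to the preimage
    -- of `j`. With the image maps of permutations of the fibres for `h i`, this is the action of a
    -- wreath product on blocks.
    punctured-permute : (τ : Permutation′ e) (h : Fin e → A → A) →
                        (∀ i → h i ∅ ≡ ∅) → (∀ i {x} → x ∈ xs → h i x ∈ xs) →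
                        ∀ {v} → v ∈ punctured e →
                        tabulate (λ i → h i (lookup v (τ ⟨$⟩ʳ i))) ∈ punctured e
    punctured-permute τ h h-∅ h-xs {v} v∈ with ∈-punctured⁻ v∈
    ... | j , eq , ∈xs = ∈-punctured⁺ (τ ⟨$⟩ˡ j)
      (begin
        lookup (tabulate (λ i → h i (lookup v (τ ⟨$⟩ʳ i)))) (τ ⟨$⟩ˡ j)
          ≡⟨ lookup∘tabulate _ (τ ⟨$⟩ˡ j) ⟩
        h (τ ⟨$⟩ˡ j) (lookup v (τ ⟨$⟩ʳ (τ ⟨$⟩ˡ j)))
          ≡⟨ cong (λ i → h (τ ⟨$⟩ˡ j) (lookup v i)) (inverseʳ τ) ⟩
        h (τ ⟨$⟩ˡ j) (lookup v j)
          ≡⟨ cong (h (τ ⟨$⟩ˡ j)) eq ⟩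
        h (τ ⟨$⟩ˡ j) ∅
          ≡⟨ h-∅ _ ⟩
        ∅
          ∎)
      (λ i i≢ → subst (_∈ xs) (sym (lookup∘tabulate _ i))
        (h-xs i (∈xs _ λ eq → i≢ (trans (sym (inverseˡ τ)) (cong (τ ⟨$⟩ˡ_) eq)))))

    -- The conditional term counts the vectors whose gap comes first; it vanishes when `p` rejects
    -- `∅`.
    count-punctured-suc :
      ∀ (p : A → Bool) (q : Vec A e → Bool) (s : Vec A (suc e) → Bool) →
      (∀ x v → s (x ∷ v) ≡ p x ∧ q v) →
      count s (punctured (suc e)) ≡
      (if p ∅ then count q (full e) else 0) + count p xs * count q (punctured e)
    count-punctured-suc {e} p q s eq
      rewrite count-++ s (map (∅ ∷_) (full e)) (cartesianProductWith _∷_ xs (punctured e))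
            | count-map s (∅ ∷_) (full e)
            | count-cong (eq ∅) (full e)
            | count-cartesianProductWith _∷_ p q s eq xs (punctured e)
      with p ∅
    ... | true  = refl
    ... | false rewrite count-false (full e) = refl

    length-punctured-suc : ∀ e → length (punctured (suc e)) ≡
                           length (full e) + length xs * length (punctured e)
    length-punctured-suc e = begin
      length (punctured (suc e))
        ≡⟨ count-true (punctured (suc e)) ⟨
      count (const true) (punctured (suc e))
        ≡⟨ count-punctured-suc {e} (const true) (const true) (const true) (λ _ _ → refl) ⟩
      count (const true) (full e) + count (const true) xs * count (const true) (punctured e)
        ≡⟨ cong₂ _+_ (count-true (full e))
             (cong₂ _*_ (count-true xs) (count-true (punctured e))) ⟩
      length (full e) + length xs * length (punctured e)
        ∎

    -- There are `e` places for the gap, and each other entry is free. The extra factor `length xs`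
    -- avoids the exponent `e - 1`.
    length-punctured : ∀ e → length xs * length (punctured e) ≡ e * length xs ^ e
    length-punctured zero    = *-zeroʳ (length xs)
    length-punctured (suc e) = begin
      b * length (punctured (suc e))
        ≡⟨ cong (b *_) (length-punctured-suc e) ⟩
      b * (length (full e) + b * length (punctured e))
        ≡⟨ cong₂ (λ f p → b * (f + p)) (length-full e) (length-punctured e) ⟩
      b * (b ^ e + e * b ^ e)
        ≡⟨ rearrange b e (b ^ e) ⟩
      suc e * b ^ suc e
        ∎
      where
      b = length xs
      rearrange : ∀ a b c → a * (c + b * c) ≡ suc b * (a * c)
      rearrange = solve-∀

    module _ (p : A → Bool) (p∅ : p ∅ ≡ false) where

      -- As `p` rejects `∅`, the gap is not at `i`, and deleting entry `i` leaves a shorter vector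
      -- with one gap.
      count-punctured : ∀ i → count (λ v → p (lookup v i)) (punctured (suc e)) ≡
                        count p xs * length (punctured e)
      count-punctured {e} zero
        rewrite count-punctured-suc {e} p (const true) (λ v → p (lookup v zero))
                  (λ x v → sym (∧-identityʳ (p x)))
              | p∅
              | count-true (punctured e) = refl
      count-punctured {suc e} (suc i)
        rewrite count-punctured-suc {suc e} (const true) (λ v → p (lookup v i))
                  (λ v → p (lookup v (suc i))) (λ x v → refl)
              | count-full p i
              | count-true xs
              | count-punctured {e} i
              | length-punctured-suc e
              = rearrange (count p xs) (length (full e)) (length xs) (length (punctured e))
        where
        rearrange : ∀ a b c d → a * b + c * (a * d) ≡ a * (b + c * d)
        rearrange = solve-∀

    -- Neither position can hold the gap, so the two entries are chosen independently and the gap is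
    -- among the other `e` positions.
    count-punctured₂ :
      ∀ (p q : A → Bool) → p ∅ ≡ false → q ∅ ≡ false → ∀ i j → i ≢ j →
      count (λ v → p (lookup v i) ∧ q (lookup v j)) (punctured (2+ e)) ≡
      count p xs * (count q xs * length (punctured e))
    count-punctured₂ p q p∅ q∅ zero zero i≢j = contradiction refl i≢j
    count-punctured₂ {e} p q p∅ q∅ zero (suc j) i≢j
      rewrite count-punctured-suc {suc e} p (λ v → q (lookup v j))
                (λ v → p (lookup v zero) ∧ q (lookup v (suc j))) (λ _ _ → refl)
            | p∅
            = cong (count p xs *_) (count-punctured q q∅ j)
    count-punctured₂ {e} p q p∅ q∅ (suc i) zero i≢j = begin
      count (λ v → p (lookup v (suc i)) ∧ q (lookup v zero)) (punctured (2+ e))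
        ≡⟨ count-cong (λ v → ∧-comm (p (lookup v (suc i))) _) (punctured (2+ e)) ⟩
      count (λ v → q (lookup v zero) ∧ p (lookup v (suc i))) (punctured (2+ e))
        ≡⟨ count-punctured₂ q p q∅ p∅ zero (suc i) (i≢j ∘ sym) ⟩
      count q xs * (count p xs * length (punctured e))
        ≡⟨ left-comm (count q xs) (count p xs) _ ⟩
      count p xs * (count q xs * length (punctured e))
        ∎
    count-punctured₂ {zero}  p q p∅ q∅ (suc zero) (suc zero) i≢j = contradiction refl i≢j
    count-punctured₂ {suc e} p q p∅ q∅ (suc i) (suc j) i≢j
      rewrite count-punctured-suc {2+ e} (const true) (λ v → p (lookup v i) ∧ q (lookup v j))
                (λ v → p (lookup v (suc i)) ∧ q (lookup v (suc j))) (λ _ _ → refl)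
            | count-full₂ {e} p q i j (i≢j ∘ cong suc)
            | count-true xs
            | count-punctured₂ {e} p q p∅ q∅ i j (i≢j ∘ cong suc)
            | length-punctured-suc e
            = rearrange (count p xs) (count q xs) (length (full e)) (length xs)
                        (length (punctured e))
      where
      rearrange : ∀ a b c d f → a * (b * c) + d * (a * (b * f)) ≡ a * (b * (c + d * f))
      rearrange = solve-∀

-- Permutations

image-flip : ∀ (g : Permutation′ n) p → image (flip g) (image g p) ≡ p
image-flip g p = vec-ext λ x → trans (lookup∘tabulate _ x)
  (trans (lookup∘tabulate _ (g ⟨$⟩ʳ x)) (cong (lookup p) (inverseˡ g)))

image-∘ₚ : ∀ (g h : Permutation′ n) p → image (g ∘ₚ h) p ≡ image h (image g p)
image-∘ₚ g h p = tabulate-cong λ y → sym (lookup∘tabulate _ (h ⟨$⟩ˡ y))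

image-cong : ∀ (g h : Permutation′ n) → (∀ y → g ⟨$⟩ˡ y ≡ h ⟨$⟩ˡ y) →
             ∀ p → image g p ≡ image h p
image-cong g h eq p = tabulate-cong λ y → cong (lookup p) (eq y)

image-id : ∀ (p : Subset n) → image idₚ p ≡ p
image-id = tabulate∘lookup

image-⊥ : ∀ (g : Permutation′ n) → image g ⊥ ≡ ⊥
image-⊥ g = vec-ext λ y → trans (lookup∘tabulate _ y)
  (trans (lookup-replicate (g ⟨$⟩ˡ y) _) (sym (lookup-replicate y _)))

-- `_≈ₚ_` compares forward maps only, whereas `image` is computed from the inverse map.
≈⇒⟨$⟩ˡ≡ : ∀ (g h : Permutation′ n) → g ≈ₚ h → ∀ y → g ⟨$⟩ˡ y ≡ h ⟨$⟩ˡ y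
≈⇒⟨$⟩ˡ≡ g h eq y = begin
  g ⟨$⟩ˡ y                          ≡⟨ cong (g ⟨$⟩ˡ_) (inverseʳ h) ⟨
  g ⟨$⟩ˡ (h ⟨$⟩ʳ (h ⟨$⟩ˡ y))        ≡⟨ cong (g ⟨$⟩ˡ_) (eq (h ⟨$⟩ˡ y)) ⟨
  g ⟨$⟩ˡ (g ⟨$⟩ʳ (h ⟨$⟩ˡ y))        ≡⟨ inverseˡ g ⟩
  h ⟨$⟩ˡ y                          ∎

transpose-source : ∀ (i j : Fin n) → transpose i j ⟨$⟩ʳ i ≡ j
transpose-source i j rewrite dec-true (i ≟ i) refl = refl

transpose-fixed : ∀ {i j k : Fin n} → k ≢ i → k ≢ j → transpose i j ⟨$⟩ʳ k ≡ k
transpose-fixed {i = i} {j} {k} k≢i k≢j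
  rewrite dec-false (k ≟ i) k≢i | dec-false (k ≟ j) k≢j = refl

⟨$⟩ʳ-injective : ∀ (g : Permutation′ n) {x y} → g ⟨$⟩ʳ x ≡ g ⟨$⟩ʳ y → x ≡ y
⟨$⟩ʳ-injective g eq = trans (sym (inverseˡ g)) (trans (cong (g ⟨$⟩ˡ_) eq) (inverseˡ g))

-- Once `τ` has sent `i` to `i′`, a second transposition corrects the image of `j`. It fixes `i′`,
-- which differs from both `τ j` and `j′`.
2-transitive : ∀ {i j i′ j′ : Fin n} → i ≢ j → i′ ≢ j′ →
               ∃[ σ ] (σ ⟨$⟩ʳ i ≡ i′) × (σ ⟨$⟩ʳ j ≡ j′)
2-transitive {i = i} {j} {i′} {j′} i≢j i′≢j′ =
  τ ∘ₚ transpose (τ ⟨$⟩ʳ j) j′ ,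
  trans (cong (transpose (τ ⟨$⟩ʳ j) j′ ⟨$⟩ʳ_) τi≡i′) (transpose-fixed i′≢τj i′≢j′) ,
  transpose-source (τ ⟨$⟩ʳ j) j′
  where
  τ = transpose i i′
  τi≡i′ : τ ⟨$⟩ʳ i ≡ i′
  τi≡i′ = transpose-source i i′
  i′≢τj : i′ ≢ τ ⟨$⟩ʳ j
  i′≢τj eq = i≢j (⟨$⟩ʳ-injective τ (trans τi≡i′ eq))

-- Wreath products

-- A view: matching on it replaces a point of the extension by its fibre `i` and the old point `x`.
data Combined (m n : ℕ) : Fin (m * n) → Set where
  ⟪_,_⟫ : (i : Fin m) (x : Fin n) → Combined m n (combine i x)

combined : ∀ m n z → Combined m n z
combined m n z with combine-surjective {m} {n} z
... | i , x , refl = ⟪ i , x ⟫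

-- `g` is indexed by the fibre where a point starts, not by the one where it lands.
act : (Fin m → Fin m) → (Fin m → Fin n → Fin n) → Fin (m * n) → Fin (m * n)
act {m} {n} σ g z = let i , x = remQuot {m} n z in combine (σ i) (g i x)

act-combine : ∀ (σ : Fin m → Fin m) (g : Fin m → Fin n → Fin n) i x →
              act σ g (combine i x) ≡ combine (σ i) (g i x)
act-combine σ g i x = cong (λ (i , x) → combine (σ i) (g i x)) (remQuot-combine i x)

act-inverse : ∀ (σ τ : Fin m → Fin m) (g h : Fin m → Fin n → Fin n) →
              (∀ i → σ (τ i) ≡ i) → (∀ i x → g (τ i) (h i x) ≡ x) →
              ∀ z → act σ g (act τ h z) ≡ z
act-inverse {m} {n} σ τ g h στ gh z with combined m n z
... | ⟪ i , x ⟫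
  rewrite act-combine τ h i x | act-combine σ g (τ i) (h i x) | στ i | gh i x = refl

wreath : Permutation′ m → (Fin m → Permutation′ n) → Permutation′ (m * n)
wreath σ g = permutation (act σʳ gʳ) (act σˡ gˡ)
  (act-inverse σʳ σˡ gʳ gˡ (λ _ → inverseʳ σ) (λ i _ → inverseʳ (g (σˡ i))))
  (act-inverse σˡ σʳ gˡ gʳ (λ _ → inverseˡ σ)
    (λ i x → trans (cong (λ j → g j ⟨$⟩ˡ (gʳ i x)) (inverseˡ σ)) (inverseˡ (g i))))
  where
  σʳ = σ ⟨$⟩ʳ_
  σˡ = σ ⟨$⟩ˡ_
  gʳ = λ i → g i ⟨$⟩ʳ_
  -- The inverse takes fibre `i` back to `σˡ i`, and it is the component of that fibre which has to
  -- be undone.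
  gˡ = λ i → g (σˡ i) ⟨$⟩ˡ_

-- `image` pulls back along the inverse map, which is an `act` both for a wreath product and for its
-- inverse. One computation thus serves `image-wreath` and `image-flip-wreath`.
lookup-concat-act : ∀ (Bs : Vec (Subset n) m) σ (g : Fin m → Fin n → Fin n) →
  tabulate (λ z → lookup (concat Bs) (act σ g z)) ≡
  concat (tabulate λ i → tabulate λ x → lookup (lookup Bs (σ i)) (g i x))
lookup-concat-act {n} {m} Bs σ g = vec-ext pointwise
  where
  pointwise : ∀ z → lookup (tabulate (λ z → lookup (concat Bs) (act σ g z))) z ≡
    lookup (concat (tabulate λ i → tabulate λ x → lookup (lookup Bs (σ i)) (g i x))) z
  pointwise z with combined m n z
  ... | ⟪ i , x ⟫
    rewrite lookup∘tabulate (λ z → lookup (concat Bs) (act σ g z)) (combine i x)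
          | act-combine σ g i x
          | lookup-concat Bs (σ i) (g i x)
          | lookup-concat (tabulate λ i → tabulate λ x → lookup (lookup Bs (σ i)) (g i x)) i x
          | lookup∘tabulate (λ i → tabulate λ x → lookup (lookup Bs (σ i)) (g i x)) i
          | lookup∘tabulate (λ x → lookup (lookup Bs (σ i)) (g i x)) x
          = refl

wreath-combine : ∀ σ (g : Fin m → Permutation′ n) i x →
                 wreath σ g ⟨$⟩ʳ combine i x ≡ combine (σ ⟨$⟩ʳ i) (g i ⟨$⟩ʳ x)
wreath-combine σ g = act-combine (σ ⟨$⟩ʳ_) (λ i → g i ⟨$⟩ʳ_)

image-wreath : ∀ σ (g : Fin m → Permutation′ n) Bs → image (wreath σ g) (concat Bs) ≡
  concat (tabulate λ i → image (g (σ ⟨$⟩ˡ i)) (lookup Bs (σ ⟨$⟩ˡ i)))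
image-wreath σ g Bs = lookup-concat-act Bs (σ ⟨$⟩ˡ_) (λ i → g (σ ⟨$⟩ˡ i) ⟨$⟩ˡ_)

image-flip-wreath : ∀ σ (g : Fin m → Permutation′ n) Bs →
  image (flip (wreath σ g)) (concat Bs) ≡
  concat (tabulate λ i → image (flip (g i)) (lookup Bs (σ ⟨$⟩ʳ i)))
image-flip-wreath σ g Bs = lookup-concat-act Bs (σ ⟨$⟩ʳ_) (λ i → g i ⟨$⟩ʳ_)

-- Sizes of subsets

∣++∣ : ∀ (p : Subset m) (q : Subset n) → ∣ p Vec.++ q ∣ ≡ ∣ p ∣ + ∣ q ∣
∣++∣ []          q = refl
∣++∣ (true  ∷ p) q = cong suc (∣++∣ p q)
∣++∣ (false ∷ p) q = ∣++∣ p q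

∣p∣≢0⇒Nonempty : ∀ (p : Subset n) .{{_ : NonZero ∣ p ∣}} → Nonempty p
∣p∣≢0⇒Nonempty {n} p with nonempty? p
... | yes ne = ne
... | no ¬ne = contradiction (trans (cong ∣_∣ (Empty-unique ¬ne)) (∣⊥∣≡0 n)) (≢-nonZero⁻¹ ∣ p ∣)

module _ {bs : List (Subset n)} {k : ℕ} (∣bs∣ : ∀ {B} → B ∈ bs → ∣ B ∣ ≡ k) where
  open Vectors bs
  open Punctured ⊥

  ∣concat-full∣ : {Bs : Vec (Subset n) e} → Bs ∈ full e → ∣ concat Bs ∣ ≡ e * k
  ∣concat-full∣ {zero}  {[]} _ = refl
  ∣concat-full∣ {suc e} Bs∈ with ∈-cartesianProductWith⁻ _∷_ bs (full e) Bs∈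
  ... | B , Bs , B∈ , Bs∈′ , refl =
    trans (∣++∣ B (concat Bs)) (cong₂ _+_ (∣bs∣ B∈) (∣concat-full∣ Bs∈′))

  ∣concat-punctured∣ : {Bs : Vec (Subset n) (suc e)} → Bs ∈ punctured (suc e) →
                       ∣ concat Bs ∣ ≡ e * k
  ∣concat-punctured∣ {e} Bs∈ with ∈-++⁻ (map (⊥ ∷_) (full e)) Bs∈
  ... | inj₁ Bs∈l with ∈-map⁻ (⊥ ∷_) Bs∈l
  ... | Bs , Bs∈′ , refl =
    trans (∣++∣ (⊥ {n}) (concat Bs)) (cong₂ _+_ (∣⊥∣≡0 n) (∣concat-full∣ Bs∈′))
  ∣concat-punctured∣ {e} Bs∈ | inj₂ Bs∈r
    with ∈-cartesianProductWith⁻ _∷_ bs (punctured e) Bs∈r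
  -- For `e = 0` the tail would belong to the empty list `punctured 0`.
  ∣concat-punctured∣ {suc e} Bs∈ | inj₂ Bs∈r | B , Bs , B∈ , Bs∈′ , refl =
    trans (∣++∣ B (concat Bs)) (cong₂ _+_ (∣bs∣ B∈) (∣concat-punctured∣ Bs∈′))

-- Designs with a chain of partitions

module _ {v} (blocks : List (Subset v)) (label : ℕ → Fin v → Fin v) where

  -- Only equality of labels matters: `g` maps classes into classes and may permute them.
  record Preserves (g : Permutation′ v) : Set where
    field
      preserves-blocks : ∀ {B} → B ∈ blocks → image g B ∈ blocks
      preserves-labels : ∀ d {x y} → label d x ≡ label d y →
                         label d (g ⟨$⟩ʳ x) ≡ label d (g ⟨$⟩ʳ y)

  -- With both directions recorded, inversion just swaps the fields, without an appeal to
  -- finiteness.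
  record Automorphism (g : Permutation′ v) : Set where
    field
      forward  : Preserves g
      backward : Preserves (flip g)

  preserves-id : Preserves idₚ
  preserves-id = record
    { preserves-blocks = λ {B} B∈ → subst (_∈ blocks) (sym (image-id B)) B∈
    ; preserves-labels = λ _ eq → eq
    }

  id-automorphism : Automorphism idₚ
  id-automorphism = record { forward = preserves-id ; backward = preserves-id }

open Preserves
open Automorphism

-- The d-th partition is into the fibres of `label d`; it gets finer as d grows.
-- The number λ = r / 2 of blocks through two points is not a field: for v = 1 there
-- are no two points, and r may be odd.
record ChainDesign (n : ℕ) : Set where
  field
    v k r    : ℕ
    blocks   : List (Subset v)
    unique   : Unique blocks
    nonempty : NonZero (length blocks)
    size     : ∀ {B} → B ∈ blocks → ∣ B ∣ ≡ k
    1+v≡2k   : suc v ≡ 2 * k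
    bk≡vr    : length blocks * k ≡ v * r
    points   : ∀ x → count (λ B → lookup B x) blocks ≡ r
    pairs    : ∀ {x y} → x ≢ y → 2 * count (λ B → lookup B x ∧ lookup B y) blocks ≡ r

    label          : ℕ → Fin v → Fin v
    label-constant : ∀ x y → label 0 x ≡ label 0 y
    label-discrete : ∀ {d} → n ≤ d → ∀ {x y} → label d x ≡ label d y → x ≡ y
    label-refines  : ∀ {d d′} → d ≤ d′ → ∀ {x y} →
                     label d′ x ≡ label d′ y → label d x ≡ label d y
    -- Allowing every `d < d′`, not only consecutive depths, lets a chain skip depths.
    label-strict   : ∀ {d d′} → d < d′ → d < n → ∀ x →
                     ∃[ y ] label d x ≡ label d y × label d′ x ≢ label d′ y

    transitive      : ∀ x y → ∃[ g ] Automorphism blocks label g × g ⟨$⟩ʳ x ≡ y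
    flag-transitive : ∀ {x B y C} → B ∈ blocks → x ∈ₛ B → C ∈ blocks → y ∈ₛ C →
                      ∃[ g ] Automorphism blocks label g × g ⟨$⟩ʳ x ≡ y × image g B ≡ C

point : ChainDesign 0
point = record
  { v = 1 ; k = 1 ; r = 1
  ; blocks = ⊤ ∷ []
  ; unique = [] ∷ []
  ; nonempty = _
  ; size = λ { (here refl) → refl }
  ; 1+v≡2k = refl
  ; bk≡vr = refl
  ; points = λ { zero → refl }
  ; pairs = λ { {zero} {zero} 0≢0 → contradiction refl 0≢0 }
  ; label = λ _ x → x
  ; label-constant = λ { zero zero → refl }
  ; label-discrete = λ _ eq → eq
  ; label-refines = λ _ eq → eq
  ; label-strict = λ _ ()
  ; transitive = λ { zero zero → idₚ , id-automorphism _ _ , refl }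
  ; flag-transitive = λ { {zero} {_} {zero} (here refl) _ (here refl) _ →
      idₚ , id-automorphism _ _ , refl , refl }
  }

-- The step from one design to the next

open Vectors

module Extend {n : ℕ} (𝒟 : ChainDesign n) where
  open ChainDesign 𝒟
  open Punctured blocks ⊥

  private instance
    b≢0 : NonZero (length blocks)
    b≢0 = nonempty

  f : ℕ
  f = 2+ v

  -- `o₂` is the number of new blocks; `o₁` and `o₀` are the numbers of ways to complete a new block
  -- once its entries on one or on two fibres are fixed and nonempty.
  b N o₀ o₁ o₂ : ℕ
  b  = length blocks
  N  = b ^ v
  o₀ = length (punctured v)
  o₁ = length (punctured (suc v))
  o₂ = length (punctured f)

  -- The balance condition for points of distinct fibres, divided by `r`: they share `r * (r * o₀)`
  -- blocks, and twice this has to be the new replication number `r * o₁`. The factor `b` turns `o₀`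
  -- and `o₁` into multiples of powers of `b`.
  2ro₀≡o₁ : 2 * (r * o₀) ≡ o₁
  2ro₀≡o₁ = *-cancelˡ-≡ _ _ b (begin
    b * (2 * (r * o₀))    ≡⟨ lemma₁ b r o₀ ⟩
    2 * r * (b * o₀)      ≡⟨ cong (2 * r *_) (length-punctured v) ⟩
    2 * r * (v * N)       ≡⟨ lemma₂ r v N ⟩
    2 * N * (v * r)       ≡⟨ cong (2 * N *_) bk≡vr ⟨
    2 * N * (b * k)       ≡⟨ lemma₃ N b k ⟩
    2 * k * (b * N)       ≡⟨ cong (_* (b * N)) 1+v≡2k ⟨
    suc v * (b * N)       ≡⟨ length-punctured (suc v) ⟨
    b * o₁                ∎)
    where
    lemma₁ : ∀ b r o → b * (2 * (r * o)) ≡ 2 * r * (b * o)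
    lemma₁ = solve-∀
    lemma₂ : ∀ r v N → 2 * r * (v * N) ≡ 2 * N * (v * r)
    lemma₂ = solve-∀
    lemma₃ : ∀ N b k → 2 * N * (b * k) ≡ 2 * k * (b * N)
    lemma₃ = solve-∀

  -- Both sides count the flags of the extension.
  o₂k′≡v′r′ : o₂ * (suc v * k) ≡ f * v * (r * o₁)
  o₂k′≡v′r′ = *-cancelˡ-≡ _ _ b (begin
    b * (o₂ * (suc v * k))                ≡⟨ lemma₁ b o₂ (suc v) k ⟩
    b * o₂ * (suc v * k)                  ≡⟨ cong (_* (suc v * k)) (length-punctured f) ⟩
    f * (b * (b * N)) * (suc v * k)       ≡⟨ lemma₂ f b N (suc v) k ⟩
    f * (suc v * (b * N)) * (b * k)       ≡⟨ cong₂ (λ p q → f * p * q)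
                                                   (sym (length-punctured (suc v))) bk≡vr ⟩
    f * (b * o₁) * (v * r)                ≡⟨ lemma₃ f b o₁ v r ⟩
    b * (f * v * (r * o₁))                ∎)
    where
    lemma₁ : ∀ b o s k → b * (o * (s * k)) ≡ b * o * (s * k)
    lemma₁ = solve-∀
    lemma₂ : ∀ f b N s k → f * (b * (b * N)) * (s * k) ≡ f * (s * (b * N)) * (b * k)
    lemma₂ = solve-∀
    lemma₃ : ∀ f b o v r → f * (b * o) * (v * r) ≡ b * (f * v * (r * o))
    lemma₃ = solve-∀

  1+v′≡2k′ : suc (f * v) ≡ 2 * (suc v * k)
  1+v′≡2k′ = begin
    suc (f * v)        ≡⟨ lemma₁ v ⟩
    suc v * suc v      ≡⟨ cong (suc v *_) 1+v≡2k ⟩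
    suc v * (2 * k)    ≡⟨ left-comm (suc v) 2 k ⟩
    2 * (suc v * k)    ∎
    where
    lemma₁ : ∀ v → suc ((2 + v) * v) ≡ suc v * suc v
    lemma₁ = solve-∀

  o₂≢0 : NonZero o₂
  o₂≢0 = m*n≢0⇒n≢0 b {{subst NonZero (sym (length-punctured f))
    (m*n≢0 f (b ^ f) {{_}} {{m^n≢0 b f}})}}

  k≢0 : NonZero k
  k≢0 = m*n≢0⇒n≢0 2 {{subst NonZero 1+v≡2k _}}

  block-nonempty : ∀ {B} → B ∈ blocks → Nonempty B
  block-nonempty {B} B∈ = ∣p∣≢0⇒Nonempty B {{subst NonZero (sym (size B∈)) k≢0}}

  -- This makes `⊥` an unambiguous mark for the missed fibre, so that no new block is listed twice.
  ⊥∉blocks : ⊥ ∉ blocks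
  ⊥∉blocks ⊥∈ with block-nonempty ⊥∈
  ... | x , x∈⊥ = ∉⊥ x∈⊥

  blocks′ : List (Subset (f * v))
  blocks′ = map concat (punctured f)

  points′ : ∀ z → count (λ B → lookup B z) blocks′ ≡ r * o₁
  points′ z with combined f v z
  ... | ⟪ i , x ⟫ = begin
    count (λ B → lookup B (combine i x)) blocks′
      ≡⟨ count-map _ concat (punctured f) ⟩
    count (λ Bs → lookup (concat Bs) (combine i x)) (punctured f)
      ≡⟨ count-cong (λ Bs → lookup-concat Bs i x) (punctured f) ⟩
    count (λ Bs → lookup (lookup Bs i) x) (punctured f)
      ≡⟨ count-punctured (λ B → lookup B x) (lookup-replicate x false) i ⟩
    count (λ B → lookup B x) blocks * o₁
      ≡⟨ cong (_* o₁) (points x) ⟩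
    r * o₁
      ∎

  pairs′ : ∀ {z w} → z ≢ w → 2 * count (λ B → lookup B z ∧ lookup B w) blocks′ ≡ r * o₁
  pairs′ {z} {w} z≢w with combined f v z | combined f v w
  ... | ⟪ i , x ⟫ | ⟪ j , y ⟫ = begin
    2 * count (λ B → lookup B (combine i x) ∧ lookup B (combine j y)) blocks′
      ≡⟨ cong (2 *_) (count-map _ concat (punctured f)) ⟩
    2 * count (λ Bs → lookup (concat Bs) (combine i x) ∧ lookup (concat Bs) (combine j y))
              (punctured f)
      ≡⟨ cong (2 *_) (count-cong
           (λ Bs → cong₂ _∧_ (lookup-concat Bs i x) (lookup-concat Bs j y)) (punctured f)) ⟩
    2 * count (λ Bs → lookup (lookup Bs i) x ∧ lookup (lookup Bs j) y) (punctured f)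
      ≡⟨ by-fibres (i ≟ j) ⟩
    r * o₁
      ∎
    where
    x∉⊥ : ∀ x → lookup (⊥ {v}) x ≡ false
    x∉⊥ x = lookup-replicate x false

    by-fibres : Dec (i ≡ j) →
      2 * count (λ Bs → lookup (lookup Bs i) x ∧ lookup (lookup Bs j) y) (punctured f) ≡ r * o₁
    -- Same fibre: both conditions fall on one entry, an old block through two distinct old points.
    by-fibres (yes refl) = begin
      2 * count (λ Bs → lookup (lookup Bs i) x ∧ lookup (lookup Bs i) y) (punctured f)
        ≡⟨ cong (2 *_) (count-punctured (λ B → lookup B x ∧ lookup B y)
             (cong₂ _∧_ (x∉⊥ x) (x∉⊥ y)) i) ⟩
      2 * (count (λ B → lookup B x ∧ lookup B y) blocks * o₁)
        ≡⟨ *-assoc 2 (count (λ B → lookup B x ∧ lookup B y) blocks) o₁ ⟨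
      2 * count (λ B → lookup B x ∧ lookup B y) blocks * o₁
        ≡⟨ cong (_* o₁) (pairs (z≢w ∘ cong (combine i))) ⟩
      r * o₁
        ∎
    -- Distinct fibres: `r` choices for each of two entries, and the gap lies among the other `v`
    -- fibres.
    by-fibres (no i≢j) = begin
      2 * count (λ Bs → lookup (lookup Bs i) x ∧ lookup (lookup Bs j) y) (punctured f)
        ≡⟨ cong (2 *_) (count-punctured₂ (λ B → lookup B x) (λ B → lookup B y)
             (x∉⊥ x) (x∉⊥ y) i j i≢j) ⟩
      2 * (count (λ B → lookup B x) blocks * (count (λ B → lookup B y) blocks * o₀))
        ≡⟨ cong₂ (λ p q → 2 * (p * (q * o₀))) (points x) (points y) ⟩
      2 * (r * (r * o₀))
        ≡⟨ left-comm 2 r (r * o₀) ⟩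
      r * (2 * (r * o₀))
        ≡⟨ cong (r *_) 2ro₀≡o₁ ⟩
      r * o₁
        ∎

  -- Depths shift by one: depth 1 separates exactly the fibres, as `label 0` is constant, and
  -- greater depths refine each fibre by the old partitions. At depth 0 the argument itself supplies
  -- the value needed in `Fin (f * v)`.
  label′ : ℕ → Fin (f * v) → Fin (f * v)
  label′ zero    = act {f} (const zero) (const (label 0))
  label′ (suc d) = act {f} id (const (label d))

  label′-suc⁻ : ∀ d (i : Fin f) x (j : Fin f) y →
                label′ (suc d) (combine i x) ≡ label′ (suc d) (combine j y) →
                i ≡ j × label d x ≡ label d y
  label′-suc⁻ d i x j y eq = combine-injective i (label d x) j (label d y)
    (trans (sym (act-combine id (const (label d)) i x))
      (trans eq (act-combine id (const (label d)) j y)))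

  label′-suc⁺ : ∀ d (i : Fin f) {x y} → label d x ≡ label d y →
                label′ (suc d) (combine i x) ≡ label′ (suc d) (combine i y)
  label′-suc⁺ d i {x} {y} eq = trans (act-combine id (const (label d)) i x)
    (trans (cong (combine i) eq) (sym (act-combine id (const (label d)) i y)))

  label′-constant : ∀ z w → label′ 0 z ≡ label′ 0 w
  label′-constant z w = cong (combine {f} zero) (label-constant _ _)

  label′-discrete : ∀ {d} → suc n ≤ d → ∀ {z w} → label′ d z ≡ label′ d w → z ≡ w
  label′-discrete {suc d} (s≤s n≤d) {z} {w} eq with combined f v z | combined f v w
  ... | ⟪ i , x ⟫ | ⟪ j , y ⟫ with label′-suc⁻ d i x j y eq
  ... | i≡j , lx≡ly = cong₂ combine i≡j (label-discrete n≤d lx≡ly)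

  label′-refines : ∀ {d d′} → d ≤ d′ → ∀ {z w} →
                   label′ d′ z ≡ label′ d′ w → label′ d z ≡ label′ d w
  label′-refines z≤n {z} {w} _ = label′-constant z w
  label′-refines {suc d} {suc d′} (s≤s d≤d′) {z} {w} eq with combined f v z | combined f v w
  ... | ⟪ i , x ⟫ | ⟪ j , y ⟫ with label′-suc⁻ d′ i x j y eq
  ... | refl , lx≡ly = label′-suc⁺ d i (label-refines d≤d′ lx≡ly)

  label′-strict : ∀ {d d′} → d < d′ → d < suc n → ∀ z →
                  ∃[ w ] label′ d z ≡ label′ d w × label′ d′ z ≢ label′ d′ w
  label′-strict {d} {suc d′} d<d′ d<1+n z with combined f v z
  label′-strict {zero} {suc d′} _ _ _ | ⟪ i , x ⟫ =
    -- The witness is the copy of `x` in some other fibre, since every positive depth separates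
    -- fibres.
    combine (punchIn i zero) x , label′-constant (combine i x) (combine (punchIn i zero) x) ,
    λ eq → punchInᵢ≢i i zero (sym (proj₁ (label′-suc⁻ d′ i x (punchIn i zero) x eq)))
  label′-strict {suc d} {suc d′} (s≤s d<d′) (s≤s d<n) _ | ⟪ i , x ⟫ with label-strict d<d′ d<n x
  ... | y , eq , neq =
    combine i y , label′-suc⁺ d i eq , λ eq′ → neq (proj₂ (label′-suc⁻ d′ i x i y eq′))

  -- Stated for `act` in order to cover a wreath product and its inverse at once.
  act-preserves-labels : ∀ (σ : Fin f → Fin f) (g : Fin f → Fin v → Fin v) →
    (∀ i d {x y} → label d x ≡ label d y → label d (g i x) ≡ label d (g i y)) →
    ∀ d {z w} → label′ d z ≡ label′ d w → label′ d (act σ g z) ≡ label′ d (act σ g w)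
  act-preserves-labels σ g hyp zero {z} {w} _ = label′-constant (act σ g z) (act σ g w)
  act-preserves-labels σ g hyp (suc d) {z} {w} eq with combined f v z | combined f v w
  ... | ⟪ i , x ⟫ | ⟪ j , y ⟫ with label′-suc⁻ d i x j y eq
  ... | refl , lx≡ly
    rewrite act-combine σ g i x | act-combine σ g i y = label′-suc⁺ d (σ i) (hyp i d lx≡ly)

  blocks′⁻ : ∀ {B} → B ∈ blocks′ → ∃[ Bs ] Bs ∈ punctured f × B ≡ concat Bs
  blocks′⁻ = ∈-map⁻ concat

  wreath-automorphism : ∀ σ (g : Fin f → Permutation′ v) →
                        (∀ i → Automorphism blocks label (g i)) →
                        Automorphism blocks′ label′ (wreath σ g)
  wreath-automorphism σ g auto = record
    { forward = record
      { preserves-blocks = fwd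
      ; preserves-labels = act-preserves-labels (σ ⟨$⟩ʳ_) (λ i → g i ⟨$⟩ʳ_)
          λ i → preserves-labels (forward (auto i))
      }
    ; backward = record
      { preserves-blocks = bwd
      ; preserves-labels = act-preserves-labels (σ ⟨$⟩ˡ_) (λ i → g (σ ⟨$⟩ˡ i) ⟨$⟩ˡ_)
          λ i → preserves-labels (backward (auto (σ ⟨$⟩ˡ i)))
      }
    }
    where
    fwd : ∀ {B} → B ∈ blocks′ → image (wreath σ g) B ∈ blocks′
    fwd B∈ with blocks′⁻ B∈
    ... | Bs , Bs∈ , refl = subst (_∈ blocks′) (sym (image-wreath σ g Bs))
      (∈-map⁺ concat (punctured-permute (flip σ) (λ i → image (g (σ ⟨$⟩ˡ i)))
        (λ i → image-⊥ (g (σ ⟨$⟩ˡ i)))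
        (λ i → preserves-blocks (forward (auto (σ ⟨$⟩ˡ i)))) Bs∈))
    bwd : ∀ {B} → B ∈ blocks′ → image (flip (wreath σ g)) B ∈ blocks′
    bwd B∈ with blocks′⁻ B∈
    ... | Bs , Bs∈ , refl = subst (_∈ blocks′) (sym (image-flip-wreath σ g Bs))
      (∈-map⁺ concat (punctured-permute σ (λ i → image (flip (g i)))
        (λ i → image-⊥ (flip (g i)))
        (λ i → preserves-blocks (backward (auto i))) Bs∈))

  transitive′ : ∀ z w → ∃[ g ] Automorphism blocks′ label′ g × g ⟨$⟩ʳ z ≡ w
  transitive′ z w with combined f v z | combined f v w
  ... | ⟪ i , x ⟫ | ⟪ j , y ⟫ with transitive x y
  ... | g , auto , gx≡y =
    wreath (transpose i j) (const g) , wreath-automorphism (transpose i j) (const g) (const auto) ,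
    trans (wreath-combine (transpose i j) (const g) i x) (cong₂ combine (transpose-source i j) gx≡y)

  -- Nonempty blocks extend to flags. This serves the fibres away from the point of a flag, where
  -- only the blocks have to correspond.
  block-transitive : ∀ {B C} → B ∈ blocks → C ∈ blocks →
                     ∃[ g ] Automorphism blocks label g × image g B ≡ C
  block-transitive B∈ C∈ with block-nonempty B∈ | block-nonempty C∈
  ... | _ , x∈B | _ , y∈C with flag-transitive B∈ x∈B C∈ y∈C
  ... | g , auto , _ , gB≡C = g , auto , gB≡C

  module _ {Bs Cs : Vec (Subset v) f} {i j i′ j′ : Fin f} {x y : Fin v}
           (Bs-j : lookup Bs j ≡ ⊥) (Bs-blocks : ∀ l → l ≢ j → lookup Bs l ∈ blocks)
           (Cs-j′ : lookup Cs j′ ≡ ⊥) (Cs-blocks : ∀ l → l ≢ j′ → lookup Cs l ∈ blocks)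
           (x∈ : x ∈ₛ lookup Bs i) (y∈ : y ∈ₛ lookup Cs i′)
           (σ : Permutation′ f) (σi≡i′ : σ ⟨$⟩ʳ i ≡ i′) (σj≡j′ : σ ⟨$⟩ʳ j ≡ j′) where

    private
      -- Three kinds of fibre occur: the missed one, where the identity will do; the one with the
      -- point of the flag, where old flag-transitivity applies; and the rest, where old
      -- block-transitivity does. The condition on the point is an implication so that all three
      -- share one type.
      fibre : ∀ l → ∃[ g ] Automorphism blocks label g ×
              image g (lookup Bs l) ≡ lookup Cs (σ ⟨$⟩ʳ l) × (l ≡ i → g ⟨$⟩ʳ x ≡ y)
      fibre l with l ≟ j | l ≟ i
      ... | yes refl | _ = idₚ , id-automorphism _ _ ,
        trans (image-id _) (trans Bs-j (sym (trans (cong (lookup Cs) σj≡j′) Cs-j′))) ,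
        λ { refl → contradiction (subst (x ∈ₛ_) Bs-j x∈) ∉⊥ }
      ... | no l≢j | yes refl
        -- The entry of `Cs` at `i′` is a block: by injectivity of `σ`, `i′ = j′` would force
        -- `i = j`.
        with flag-transitive (Bs-blocks l l≢j) x∈ (Cs-blocks i′ λ i′≡j′ →
               l≢j (⟨$⟩ʳ-injective σ (trans σi≡i′ (trans i′≡j′ (sym σj≡j′))))) y∈
      ...   | g , auto , gx≡y , gB≡C =
        g , auto , trans gB≡C (cong (lookup Cs) (sym σi≡i′)) , λ _ → gx≡y
      fibre l | no l≢j | no l≢i
        with block-transitive (Bs-blocks l l≢j) (Cs-blocks (σ ⟨$⟩ʳ l)
               λ σl≡j′ → l≢j (⟨$⟩ʳ-injective σ (trans σl≡j′ (sym σj≡j′))))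
      ... | g , auto , gB≡C = g , auto , gB≡C , λ l≡i → contradiction l≡i l≢i

      g : Fin f → Permutation′ v
      g l = proj₁ (fibre l)

    wreath-flag-transitive : ∃[ h ] Automorphism blocks′ label′ h ×
      h ⟨$⟩ʳ combine i x ≡ combine i′ y × image h (concat Bs) ≡ concat Cs
    wreath-flag-transitive =
      wreath σ g ,
      wreath-automorphism σ g (λ l → proj₁ (proj₂ (fibre l))) ,
      trans (wreath-combine σ g i x) (cong₂ combine σi≡i′ (proj₂ (proj₂ (proj₂ (fibre i))) refl)) ,
      trans (image-wreath σ g Bs) (cong concat (trans
        (tabulate-cong λ l → trans (proj₁ (proj₂ (proj₂ (fibre (σ ⟨$⟩ˡ l)))))
                                   (cong (lookup Cs) (inverseʳ σ)))
        (tabulate∘lookup Cs)))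

  ∈-fibre : ∀ (Bs : Vec (Subset v) f) (i : Fin f) x →
            combine i x ∈ₛ concat Bs → x ∈ₛ lookup Bs i
  ∈-fibre Bs i x ∈ = lookup⇒[]= x _ (trans (sym (lookup-concat Bs i x)) ([]=⇒lookup ∈))

  nonempty≢empty : ∀ (Bs : Vec (Subset v) f) {i j : Fin f} {x} →
                   x ∈ₛ lookup Bs i → lookup Bs j ≡ ⊥ → i ≢ j
  nonempty≢empty Bs {x = x} x∈ Bs-j refl = ∉⊥ (subst (x ∈ₛ_) Bs-j x∈)

  flag-transitive′ : ∀ {z B w C} → B ∈ blocks′ → z ∈ₛ B → C ∈ blocks′ → w ∈ₛ C →
    ∃[ g ] Automorphism blocks′ label′ g × g ⟨$⟩ʳ z ≡ w × image g B ≡ C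
  flag-transitive′ {z} {B} {w} {C} B∈ z∈ C∈ w∈
    with combined f v z | combined f v w | blocks′⁻ B∈ | blocks′⁻ C∈
  ... | ⟪ i , x ⟫ | ⟪ i′ , y ⟫ | Bs , Bs∈ , refl | Cs , Cs∈ , refl
    with ∈-punctured⁻ Bs∈ | ∈-punctured⁻ Cs∈
  ... | j , Bs-j , Bs-blocks | j′ , Cs-j′ , Cs-blocks
    -- The permutation of the fibres must match the fibres of the two points and the two missed
    -- fibres simultaneously.
    with 2-transitive (nonempty≢empty Bs (∈-fibre Bs i x z∈) Bs-j)
                      (nonempty≢empty Cs (∈-fibre Cs i′ y w∈) Cs-j′)
  ... | σ , σi≡i′ , σj≡j′ =
    wreath-flag-transitive {Bs} {Cs} Bs-j Bs-blocks Cs-j′ Cs-blocks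
      (∈-fibre Bs i x z∈) (∈-fibre Cs i′ y w∈) σ σi≡i′ σj≡j′

  extension : ChainDesign (suc n)
  extension = record
    { v = f * v ; k = suc v * k ; r = r * o₁
    ; blocks = blocks′
    ; unique = Unique.map⁺ concat-injective (punctured-unique ⊥∉blocks unique f)
    ; nonempty = subst NonZero (sym (length-map concat (punctured f))) o₂≢0
    ; size = λ B∈ → size′ (blocks′⁻ B∈)
    ; 1+v≡2k = 1+v′≡2k′
    ; bk≡vr = trans (cong (_* (suc v * k)) (length-map concat (punctured f))) o₂k′≡v′r′
    ; points = points′
    ; pairs = pairs′
    ; label = label′
    ; label-constant = label′-constant
    ; label-discrete = label′-discrete
    ; label-refines = label′-refines
    ; label-strict = label′-strict
    ; transitive = transitive′
    ; flag-transitive = flag-transitive′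
    }
    where
    size′ : ∀ {B} → ∃[ Bs ] Bs ∈ punctured f × B ≡ concat Bs → ∣ B ∣ ≡ suc v * k
    size′ (Bs , Bs∈ , refl) = ∣concat-punctured∣ size Bs∈

-- Iteration and passage to 2-designs

level : ∀ n → ChainDesign n
level zero    = point
level (suc n) = Extend.extension (level n)

does-∈? : ∀ (x : Fin n) p → does (x ∈? p) ≡ lookup p x
does-∈? zero    (true  ∷ p) = refl
does-∈? zero    (false ∷ p) = refl
does-∈? (suc x) (_ ∷ p)     = does-∈? x p

-- By `pairs`, `r` is even as soon as there are two distinct points, so `r / 2` is exact there; for
-- `point` it is a default value.
toDesign : ChainDesign n → 2-Design
toDesign 𝒟 = record { v = v ; k = k ; lam = r / 2 ; design = record
  { blocks    = blocks
  ; unique    = unique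
  ; nonempty  = λ { refl → ≢-nonZero⁻¹ _ {{nonempty}} refl }
  ; blockSize = size
  ; balanced  = balanced
  } }
  where
  open ChainDesign 𝒟
  balanced : ∀ {x y} → x ≢ y →
             length (filter (λ B → x ∈? B ×-dec y ∈? B) blocks) ≡ r / 2
  balanced {x} {y} x≢y = begin
    length (filter (λ B → x ∈? B ×-dec y ∈? B) blocks)
      ≡⟨ length-filter≡count (λ B → x ∈? B ×-dec y ∈? B) (λ B → lookup B x ∧ lookup B y)
           (λ B → cong₂ _∧_ (does-∈? x B) (does-∈? y B)) blocks ⟩
    c
      ≡⟨ m*n/n≡m c 2 ⟨
    c * 2 / 2
      ≡⟨ cong (_/ 2) (trans (*-comm c 2) (pairs x≢y)) ⟩
    r / 2
      ∎
    where
    c = count (λ B → lookup B x ∧ lookup B y) blocks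

-- The partition into the fibres of a map

module _ (f : Fin n → Fin m) where

  fibreOf : Fin n → Subset n
  fibreOf x = tabulate λ y → does (f x ≟ f y)

  ∈-fibreOf⁺ : ∀ {x y} → f x ≡ f y → y ∈ₛ fibreOf x
  ∈-fibreOf⁺ {x} {y} eq = lookup⇒[]= y _
    (trans (lookup∘tabulate _ y) (dec-true (f x ≟ f y) eq))

  ∈-fibreOf⁻ : ∀ {x y} → y ∈ₛ fibreOf x → f x ≡ f y
  ∈-fibreOf⁻ {x} {y} y∈ with f x ≟ f y | trans (sym (lookup∘tabulate _ y)) ([]=⇒lookup y∈)
  ... | yes eq | _ = eq

  fibreOf-cong : ∀ {x y} → f x ≡ f y → fibreOf x ≡ fibreOf y
  fibreOf-cong eq = tabulate-cong λ z → cong (λ a → does (a ≟ f z)) eq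

  fibres : Partition n
  fibres = record
    { IsClass  = λ p → ∃[ x ] p ≡ fibreOf x
    ; nonempty = λ { (x , refl) → x , ∈-fibreOf⁺ refl }
    ; covering = λ x → fibreOf x , (x , refl) , ∈-fibreOf⁺ refl
    ; disjoint = λ { (x , refl) (y , refl) z∈x z∈y →
        fibreOf-cong (trans (∈-fibreOf⁻ z∈x) (sym (∈-fibreOf⁻ z∈y))) }
    }

  -- The two hypotheses give the two inclusions by which `g` carries the fibre through `x` onto the
  -- fibre through its image. The converse half of the equivalence then follows from injectivity of
  -- `image g`.
  fibres-invariant : ∀ (g : Permutation′ n) →
    (∀ {x y} → f x ≡ f y → f (g ⟨$⟩ʳ x) ≡ f (g ⟨$⟩ʳ y)) →
    (∀ {x y} → f x ≡ f y → f (g ⟨$⟩ˡ x) ≡ f (g ⟨$⟩ˡ y)) →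
    MapsOnto g (IsClass fibres) (IsClass fibres)
  fibres-invariant g resp resp⁻¹ p = mk⇔
    (λ { (x , refl) → g ⟨$⟩ʳ x , image-fibreOf x })
    (λ (x , gp≡x) → g ⟨$⟩ˡ x , image-injective (begin
      image g p                             ≡⟨ gp≡x ⟩
      fibreOf x                             ≡⟨ cong fibreOf (inverseʳ g) ⟨
      fibreOf (g ⟨$⟩ʳ (g ⟨$⟩ˡ x))           ≡⟨ image-fibreOf (g ⟨$⟩ˡ x) ⟨
      image g (fibreOf (g ⟨$⟩ˡ x))          ∎))
    where
    image-injective : ∀ {p q} → image g p ≡ image g q → p ≡ q
    image-injective {p} {q} eq =
      trans (sym (image-flip g p)) (trans (cong (image (flip g)) eq) (image-flip g q))
    image-fibreOf : ∀ x → image g (fibreOf x) ≡ fibreOf (g ⟨$⟩ʳ x)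
    image-fibreOf x = tabulate-cong λ y → trans (lookup∘tabulate _ (g ⟨$⟩ˡ y))
      (does-⇔ (mk⇔ (λ eq → trans (resp eq) (cong f (inverseʳ g)))
                   (λ eq → trans (cong f (sym (inverseˡ g))) (resp⁻¹ eq)))
              (f x ≟ f (g ⟨$⟩ˡ y)) (f (g ⟨$⟩ʳ x) ≟ f y))

module _ (f : Fin n → Fin m) (f′ : Fin n → Fin o) where

  fibres-≺ : (∀ {x y} → f x ≡ f y → f′ x ≡ f′ y) →
             (∀ x → ∃[ y ] f′ x ≡ f′ y × f x ≢ f y) → fibres f ≺ fibres f′
  fibres-≺ refines strict {p} (x , refl) with strict x
  ... | y , f′x≡f′y , fx≢fy =
    fibreOf f′ x , (x , refl) ,
    (λ z∈ → ∈-fibreOf⁺ f′ (refines (∈-fibreOf⁻ f z∈))) ,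
    y , ∈-fibreOf⁺ f′ f′x≡f′y , λ y∈ → fx≢fy (∈-fibreOf⁻ f y∈)

injective⇒fibreOf≡⁅⁆ : ∀ {f : Fin n → Fin m} → (∀ {x y} → f x ≡ f y → x ≡ y) →
                       ∀ x → fibreOf f x ≡ ⁅ x ⁆
injective⇒fibreOf≡⁅⁆ {f = f} inj x = ⊆-antisym
  (λ y∈ → subst (_∈ₛ ⁅ x ⁆) (inj (∈-fibreOf⁻ f y∈)) (x∈⁅x⁆ x))
  (λ y∈ → ∈-fibreOf⁺ f (cong f (sym (x∈⁅y⁆⇒x≡y x y∈))))

constant⇒fibreOf≡⊤ : ∀ {f : Fin n → Fin m} → (∀ x y → f x ≡ f y) → ∀ x → fibreOf f x ≡ ⊤
constant⇒fibreOf≡⊤ {f = f} constant x = ⊆-antisym (λ _ → ∈⊤) (λ {y} _ → ∈-fibreOf⁺ f (constant x y))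

-- The group and its invariant chain

module AutomorphismGroup {n : ℕ} (𝒟 : ChainDesign n) where
  open ChainDesign 𝒟

  preserves-resp : ∀ {g h} → (∀ x → g ⟨$⟩ʳ x ≡ h ⟨$⟩ʳ x) → (∀ x → g ⟨$⟩ˡ x ≡ h ⟨$⟩ˡ x) →
                   Preserves blocks label g → Preserves blocks label h
  preserves-resp {g} {h} eqʳ eqˡ pres = record
    { preserves-blocks = λ {B} B∈ →
        subst (_∈ blocks) (image-cong g h eqˡ B) (preserves-blocks pres B∈)
    ; preserves-labels = λ d {x} {y} eq →
        subst₂ (λ x y → label d x ≡ label d y) (eqʳ x) (eqʳ y) (preserves-labels pres d eq)
    }

  preserves-∘ : ∀ {g h} → Preserves blocks label g → Preserves blocks label h →
                Preserves blocks label (g ∘ₚ h)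
  preserves-∘ {g} {h} pg ph = record
    { preserves-blocks = λ {B} B∈ →
        subst (_∈ blocks) (sym (image-∘ₚ g h B)) (preserves-blocks ph (preserves-blocks pg B∈))
    ; preserves-labels = λ d eq → preserves-labels ph d (preserves-labels pg d eq)
    }

  -- All automorphisms compatible with the labels are taken, not only iterated wreath products:
  -- closure and invariance are then direct, and the wreath products inside give transitivity.
  group : PermutationGroup v
  group = record
    { member    = Automorphism blocks label
    ; resp-≈    = λ {g} {h} eq auto → record
      { forward  = preserves-resp eq (≈⇒⟨$⟩ˡ≡ g h eq) (forward auto)
      ; backward = preserves-resp (≈⇒⟨$⟩ˡ≡ g h eq) eq (backward auto)
      }
    ; id-closed = id-automorphism blocks label
    ; ∘-closed  = λ {g} {h} ag ah → record
      { forward  = preserves-∘ (forward ag) (forward ah)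
      -- The two permutations have the same maps but need not carry the same inverse proofs.
      ; backward = preserves-resp {flip h ∘ₚ flip g} {flip (g ∘ₚ h)} (λ _ → refl) (λ _ → refl)
          (preserves-∘ (backward ah) (backward ag))
      }
    ; ⁻¹-closed = λ {g} ag → record
      { forward  = backward ag
      ; backward = preserves-resp {g} {flip (flip g)} (λ _ → refl) (λ _ → refl) (forward ag)
      }
    }

  group≤Aut : SubgroupOfAut (toDesign 𝒟) group
  group≤Aut {g} auto B = mk⇔ (preserves-blocks (forward auto))
    (λ gB∈ → subst (_∈ blocks) (image-flip g B) (preserves-blocks (backward auto) gB∈))

  group-flag-transitive : FlagTransitive (toDesign 𝒟) group
  group-flag-transitive (B∈ , x∈B) (C∈ , y∈C) = flag-transitive B∈ x∈B C∈ y∈C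

  module _ {s : ℕ} (s<n : s < n) (x₀ : Fin v) where

    -- The given chain has n + 1 partitions: keep the coarsest suc s of them, and
    -- then jump to the discrete one.
    depth : Fin (2+ s) → ℕ
    depth zero    = n
    depth (suc i) = s ∸ toℕ i

    depth-decreasing : ∀ i → depth (suc i) < depth (inject₁ i)
    depth-decreasing zero    = s<n
    depth-decreasing (suc i) = subst (λ j → s ∸ suc (toℕ i) < s ∸ j) (sym (toℕ-inject₁ i))
      (∸-monoʳ-< (n<1+n (toℕ i)) (toℕ<n i))

    depth<n : ∀ i → depth (suc i) < n
    depth<n i = ≤-<-trans (m∸n≤m s (toℕ i)) s<n

    chain : Fin (2+ s) → Partition v
    chain i = fibres (label (depth i))

    depth-top : depth (fromℕ (suc s)) ≡ 0
    depth-top = trans (cong (s ∸_) (toℕ-fromℕ s)) (n∸n≡0 s)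

    bottom≡⁅⁆ : ∀ x → fibreOf (label n) x ≡ ⁅ x ⁆
    bottom≡⁅⁆ = injective⇒fibreOf≡⁅⁆ (label-discrete ≤-refl)

    top≡⊤ : ∀ x → fibreOf (label (depth (fromℕ (suc s)))) x ≡ ⊤
    top≡⊤ = constant⇒fibreOf≡⊤
      (subst (λ d → ∀ x y → label d x ≡ label d y) (sym depth-top) label-constant)

    chain-imprimitive : ChainImprimitive (suc s) group
    chain-imprimitive = record
      { transitive = transitive
      ; chain      = chain
      ; increasing = λ i → fibres-≺ _ _ (label-refines (<⇒≤ (depth-decreasing i)))
                                        (label-strict (depth-decreasing i) (depth<n i))
      ; bottom     = (λ { (x , refl) → x , bottom≡⁅⁆ x })
                   , (λ { (x , refl) → x , sym (bottom≡⁅⁆ x) })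
      -- Classes are given by representatives, so a point is needed to exhibit `⊤` as a class.
      ; top        = (λ { (x , refl) → top≡⊤ x }) , (λ { refl → x₀ , sym (top≡⊤ x₀) })
      ; invariant  = λ i {g} auto → fibres-invariant (label (depth i)) g
          (preserves-labels (forward auto) (depth i)) (preserves-labels (backward auto) (depth i))
      }

-- Numbers of points, and the infinite family

-- The values are 1, 3, 15, 255, and in general 2^(2^n) - 1. Being distinct, they tell the designs
-- apart up to isomorphism.
v-level : ℕ → ℕ
v-level n = ChainDesign.v (level n)

v-level≢0 : ∀ n → NonZero (v-level n)
v-level≢0 zero    = _
v-level≢0 (suc n) = m*n≢0 (2+ v) v {{_}} {{v-level≢0 n}}
  where v = v-level n

v-level-increasing : ∀ {i j} → i <′ j → v-level i < v-level j
v-level-increasing {i} ≤′-refl = subst (v <_) (*-comm v (2+ v))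
  (m<m*n v (2+ v) {{v-level≢0 i}} (s≤s (s≤s z≤n)))
  where v = v-level i
v-level-increasing (≤′-step {j} i<j) =
  <-trans (v-level-increasing i<j) (v-level-increasing {j} ≤′-refl)

v-level-injective : ∀ {i j} → v-level i ≡ v-level j → i ≡ j
v-level-injective {i} {j} eq with <-cmp i j
... | tri< i<j _ _ = contradiction eq (<⇒≢ (v-level-increasing (<⇒<′ i<j)))
... | tri≈ _ i≡j _ = i≡j
... | tri> _ _ j<i = contradiction (sym eq) (<⇒≢ (v-level-increasing (<⇒<′ j<i)))

3≤v-level-suc : ∀ n → 3 ≤ v-level (suc n)
3≤v-level-suc n = ≤-trans (s≤s (s≤s (>-nonZero⁻¹ v {{v-level≢0 n}})))
                          (m≤m*n (2+ v) v {{v-level≢0 n}})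
  where v = v-level n

module _ {n : ℕ} (𝒟 : ChainDesign n) (3≤v : 3 ≤ ChainDesign.v 𝒟) where
  open ChainDesign 𝒟

  2≤k : 2 ≤ k
  2≤k = *-cancelˡ-≤ 2 (subst (4 ≤_) 1+v≡2k (s≤s 3≤v))

  -- Here 2k = v + 1 < v + v.
  k<v : k < v
  k<v = *-cancelˡ-< 2 k v (subst₂ _<_ 1+v≡2k (cong (v +_) (sym (+-identityʳ v)))
    (+-monoˡ-≤ v (≤-trans (n≤1+n 2) 3≤v)))

theorem1p1 : ∀ (s : ℕ) → 2 ≤ s →
    Σ[ 𝒟 ∈ (ℕ → 2-Design) ]
    (∀ {i j} → i ≢ j → ¬ Isomorphic (𝒟 i) (𝒟 j)) ×
    (∀ i → 2 ≤ 2-Design.k (𝒟 i) ×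
    2-Design.k (𝒟 i) < 2-Design.v (𝒟 i) ×
    (∃[ G ] SubgroupOfAut (𝒟 i) G ×
    FlagTransitive (𝒟 i) G ×
    ChainImprimitive s G))
-- Level `suc s + i` has `i` more partitions than the chain asked for, and distinct `i` give
-- distinct levels.
theorem1p1 (suc s) _ = (λ i → toDesign (level (suc s + i))) ,
  -- The bijection of points underlying an isomorphism already forces equal numbers of points.
  (λ {i} {j} i≢j (π , _) → i≢j (+-cancelˡ-≡ (suc s) i j (v-level-injective (↔⇒≡ π)))) ,
  λ i → let 𝒟 = level (suc s + i) ; open AutomorphismGroup 𝒟 in
    2≤k 𝒟 (3≤v-level-suc (s + i)) ,
    k<v 𝒟 (3≤v-level-suc (s + i)) ,
    group , group≤Aut , group-flag-transitive ,
    chain-imprimitive (s≤s (m≤m+n s i))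
      (fromℕ< (>-nonZero⁻¹ (v-level (suc s + i)) {{v-level≢0 (suc s + i)}}))
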